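{- Let $V=\{0,\tfrac12,1\}$ and consider any sentential language with an atomic expressive semantics whose consequence relation is induced by the truth-relation $ss\cap tt$. Then no unary connective of the language (with any truth function) is a G-negation.
   Context: $ss\cap tt=\models_{\{1\},\{1\}}\cap\models_{\{1,\frac12\},\{1,\frac12\}}$, where $\gamma\models_{\mathcal{D}_p,\mathcal{D}_c}\delta$ iff ($\gamma\subseteq\mathcal{D}_p\Rightarrow\delta\cap\mathcal{D}_c\neq\emptyset$). A semantics: set of valuations mapping atoms to $V$, interpreting each connective by a truth function fixed across valuations, extended compositionally, such that every assignment of values to finitely many distinct atoms is realized. Atomic expressive: for every $\gamma\subseteq V$ there are a set of formulas $\Gamma$ and a valuation $v$ with $v(\Gamma)=\gamma$. Consequence: $\Gamma\vdash\Delta$ iff $v(\Gamma)\models v(\Delta)$ for all $v$; $\Gamma,A$ denotes $\Gamma\cup\{A\}$. A G-negation $\neg$ satisfies for all $\Gamma,\Delta,A$: $\Gamma,\neg A\vdash\Delta$ iff $\Gamma\vdash A,\Delta$; and $\Gamma\vdash\neg A,\Delta$ iff $\Gamma,A\vdash\Delta$. -}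

module Defs where

open import Level using (Level; 0ℓ; _⊔_) renaming (suc to lsuc)
open import Data.Nat.Base using (ℕ)
open import Data.Fin.Base using (Fin)
open import Data.Vec.Base using (Vec; []; _∷_)
open import Data.Product.Base using (Σ-syntax; ∃-syntax; _×_)
open import Function.Bundles using (_⇔_)
open import Function.Definitions using (Injective)
open import Relation.Binary.Core using (Rel)
import Relation.Binary.Construct.Intersection as Rel
open import Relation.Binary.PropositionalEquality.Core using (_≡_)
open import Relation.Unary using (Pred; _∈_; _⊆_; _≐_; _∪_; _≬_; ｛_｝)

private
  variable
    a c w ℓ : Level

record Language (a c : Level) : Set (lsuc (a ⊔ c)) where
  field
    Atom       : Set a
    Connective : ℕ → Set c  -- indexed by arity

module _ (L : Language a c) where
  open Language L

  data Formula : Set (a ⊔ c) where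
    atom : Atom → Formula
    con  : ∀ {n} → Connective n → Vec Formula n → Formula

  FormulaSet : Set (lsuc (a ⊔ c))
  FormulaSet = Pred Formula (a ⊔ c)

  module _ (V : Set) where

    TruthFunctions : Set c
    TruthFunctions = ∀ {n} → Connective n → Vec V n → V

    module _ (fn : TruthFunctions) (v : Atom → V) where
      mutual
        extend : Formula → V
        extend (atom p)   = v p
        extend (con k As) = fn k (extends As)

        extends : ∀ {n} → Vec Formula n → Vec V n
        extends []       = []
        extends (A ∷ As) = extend A ∷ extends As

    record Semantics (w : Level) : Set (a ⊔ c ⊔ lsuc w) where
      field
        Valuation     : Pred (Atom → V) w
        truthFunction : TruthFunctions
        realize       : ∀ {n} (p : Fin n → Atom) → Injective _≡_ _≡_ p →
                        (x : Fin n → V) →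
                        ∃[ v ] v ∈ Valuation × (∀ i → v (p i) ≡ x i)

      ⟦_⟧ : Formula → (Atom → V) → V
      ⟦ A ⟧ v = extend truthFunction v A

      -- The direct image v(Γ).
      image : (Atom → V) → FormulaSet → Pred V (a ⊔ c)
      image v Γ x = ∃[ A ] A ∈ Γ × ⟦ A ⟧ v ≡ x

TruthRelation : Set → (ℓ : Level) → Set (lsuc ℓ)
TruthRelation V ℓ = Rel (Pred V ℓ) ℓ

mixed : {V : Set} → Pred V 0ℓ → Pred V 0ℓ → TruthRelation V ℓ
mixed Dp Dc γ δ = γ ⊆ Dp → δ ≬ Dc

module _ {L : Language a c} {V : Set} (S : Semantics L V w) where
  open Semantics S

  AtomicExpressive : Set (lsuc (a ⊔ c) ⊔ w)
  AtomicExpressive = (γ : Pred V 0ℓ) →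
    Σ[ Γ ∈ FormulaSet L ] ∃[ v ] v ∈ Valuation × image v Γ ≐ γ

  Consequence : TruthRelation V (a ⊔ c) → Rel (FormulaSet L) (a ⊔ c ⊔ w)
  Consequence _⊨_ Γ Δ = ∀ v → v ∈ Valuation → image v Γ ⊨ image v Δ

module _ {L : Language a c} where
  open Language L

  infixl 6 _,,_

  -- Γ, A; premise and conclusion sets being unordered, A, Δ is Δ ,, A as well.
  _,,_ : FormulaSet L → Formula L → FormulaSet L
  Γ ,, A = Γ ∪ ｛ A ｝

  record IsGNegation (_⊢_ : Rel (FormulaSet L) ℓ) (neg : Connective 1) :
                     Set (lsuc (a ⊔ c) ⊔ ℓ) where
    ¬'_ : Formula L → Formula L
    ¬' A = con neg (A ∷ [])

    field
      premise    : ∀ Γ Δ A → ((Γ ,, ¬' A) ⊢ Δ) ⇔ (Γ ⊢ (Δ ,, A))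
      conclusion : ∀ Γ Δ A → (Γ ⊢ (Δ ,, ¬' A)) ⇔ ((Γ ,, A) ⊢ Δ)

data Three : Set where
  0# ½ 1# : Three

ss tt ss∩tt : TruthRelation Three ℓ
ss    = mixed ｛ 1# ｝ ｛ 1# ｝
tt    = mixed (｛ 1# ｝ ∪ ｛ ½ ｝) (｛ 1# ｝ ∪ ｛ ½ ｝)
ss∩tt = ss Rel.∩ tt

-- Under ss ∩ tt, Γ ⊢ Δ says that min v(Γ) ≤ max v(Δ) for every valuation v.
-- Take v(A) = ½.  A G-negation turns A ⊢ A into A, ¬A ⊢ ∅, where tt forces
-- v(¬A) = 0, and also into ∅ ⊢ A, ¬A, where ss forces v(¬A) = 1.

module Submission where

open import Defs
open import Data.Product.Base using (∃₂; _×_; _,_; proj₁; proj₂)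
open import Data.Sum.Base using (inj₁; inj₂)
open import Function.Bundles using (Equivalence)
open import Level using (Level)
open import Relation.Binary.PropositionalEquality.Core using (_≡_; refl; sym; trans)
open import Relation.Nullary.Negation.Core using (¬_)
open import Relation.Unary using (_∈_; _⊆_; _≬_; ｛_｝)
open import Relation.Unary.Polymorphic using (∅)

private
  variable
    a c w : Level

module _ {L : Language a c} (S : Semantics L Three w) where
  open Semantics S

  private
    _⊢_ = Consequence S ss∩tt

  -- In `ss` and in `tt` alike, premises and conclusions share one designated set, so a common
  -- formula carries designation across.
  overlap⇒⊢ : ∀ {Γ Δ} → Γ ≬ Δ → Γ ⊢ Δ
  overlap⇒⊢ (A , A∈Γ , A∈Δ) v _ =
    (λ ⊆D → _ , (A , A∈Δ , refl) , ⊆D (A , A∈Γ , refl)) ,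
    (λ ⊆D → _ , (A , A∈Δ , refl) , ⊆D (A , A∈Γ , refl))

  -- `realize` yields no formula if there are no atoms; here one comes from the nonempty image
  -- `｛ x ｝`.
  expressible : AtomicExpressive S → ∀ x →
                ∃₂ λ A v → v ∈ Valuation × ⟦ A ⟧ v ≡ x
  expressible express x with express ｛ x ｝
  ... | _ , v , v∈ , _ , ｛x｝⊆image with ｛x｝⊆image refl
  ... | A , _ , ⟦A⟧≡x = A , v , v∈ , ⟦A⟧≡x

theorem4p3 : ∀ {a c w : Level} (L : Language a c) (S : Semantics L Three w) →
    AtomicExpressive S →
    (neg : Language.Connective L 1) →
    ¬ IsGNegation (Consequence S ss∩tt) neg
theorem4p3 L S express neg isGNegation
  with A , v , v∈ , ⟦A⟧≡½ ← expressible S express ½ = absurd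
  where
  open Semantics S
  open IsGNegation isGNegation

  contradictory : Consequence S ss∩tt (｛ A ｝ ,, ¬' A) ∅
  contradictory = Equivalence.from (premise ｛ A ｝ ∅ A)
    (overlap⇒⊢ S (A , refl , inj₂ refl))

  exhaustive : Consequence S ss∩tt ∅ (｛ A ｝ ,, ¬' A)
  exhaustive = Equivalence.from (conclusion ∅ ｛ A ｝ A)
    (overlap⇒⊢ S (A , inj₂ refl , refl))

  -- Otherwise both premises of `contradictory` would be designated for `tt`, with no conclusion to
  -- match. Excluding `1#` is enough, as `ss` asks for exactly that value.
  ⟦¬A⟧≢1 : ¬ 1# ≡ ⟦ ¬' A ⟧ v
  ⟦¬A⟧≢1 1≡⟦¬A⟧ with proj₂ (contradictory v v∈)
      (λ { (_ , inj₁ refl , refl) → inj₂ (sym ⟦A⟧≡½)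
         ; (_ , inj₂ refl , refl) → inj₁ 1≡⟦¬A⟧ })
  ... | _ , (_ , () , _) , _

  absurd : _
  -- Without premises the `ss` condition is vacuous, so `A` or `¬' A` must take the value `1#`.
  absurd with proj₁ (exhaustive v v∈) (λ { (_ , () , _) })
  ... | _ , (_ , inj₁ refl , ⟦A⟧≡x)  , 1≡x with () ← trans (sym ⟦A⟧≡½) (trans ⟦A⟧≡x (sym 1≡x))
  ... | _ , (_ , inj₂ refl , ⟦¬A⟧≡x) , 1≡x = ⟦¬A⟧≢1 (trans 1≡x (sym ⟦¬A⟧≡x))
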